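{- The hypergraph polynomials $T_{\mathrm{HG}}$, $Z_{\mathrm{P}}$ and $Z_{\mathrm{Grimmett}}$ are pairwise incomparable in distinguishing power, even among hypergraphs with the same global parameters, i.e. the same number of vertices, of components, of edges, and the same total degree. That is, for any two distinct $F_1,F_2\in\{T_{\mathrm{HG}},Z_{\mathrm{P}},Z_{\mathrm{Grimmett}}\}$ there exist hypergraphs $H,H'$ with $v(H)=v(H')$, $\kappa(H)=\kappa(H')$, $|E(H)|=|E(H')|$, $d(E(H))=d(E(H'))$ such that $F_1(H)=F_1(H')$ but $F_2(H)\ne F_2(H')$.
   Context: A hypergraph is a pair $H=(V,E)$ where $V$ is a finite set and $E=E(H)$ is a finite multiset (parallel hyperedges are allowed and treated as distinct elements of $E$) of multisets of elements of $V$, called hyperedges. For $e\in E$, $d(e)$ is the size of $e$ counted with multiplicity; it is always assumed that $d(e)>1$. Write $v(H)=|V|$. $\kappa(H)$ is the number of connected components of the bipartite incidence graph with vertex classes $V$ and $E$, in which $u\in V$ and $e\in E$ are joined by as many edges as the multiplicity of $u$ in $e$. For $A\subseteq E$ let $\kappa(A)=\kappa((V,A))$, $d(A)=\sum_{e\in A}d(e)$, and $|A|$ is the number of hyperedges in $A$. The polynomials are $T_{\mathrm{HG}}(H;x,y)=\sum_{A\subseteq E}(x-1)^{\kappa(A)-\kappa(H)}(y-1)^{d(A)-|A|-v(H)+\kappa(A)}$, $Z_{\mathrm{P}}(H;q,w)=\sum_{A\subseteq E}q^{\kappa(A)}\prod_{e\in A}(w^{d(e)-1}-1)$, $Z_{\mathrm{Grimmett}}(H;q,w)=\sum_{A\subseteq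 E}q^{\kappa(A)}(w-1)^{|A|}$. A hypergraph invariant $F_1$ is less distinguishing than $F_2$ if $F_2(H)=F_2(H')$ implies $F_1(H)=F_1(H')$ for all $H,H'$; $F_1,F_2$ are incomparable in distinguishing power if neither is less distinguishing than the other. -}

module Defs where

open import Algebra.Bundles using (RawRing)
import Algebra.Definitions.RawSemiring as RawSemiringDefs
open import Data.Fin using (Fin; _↑ˡ_; _↑ʳ_; _≟_)
open import Data.Integer using (+-*-rawRing)
open import Data.List as List
  using (List; []; _∷_; _++_; allFin; concatMap; deduplicate; foldr; length; replicate)
open import Data.List.Membership.Propositional using (_∈_)
open import Data.List.Relation.Unary.Any using (here; there)
open import Data.Nat using (ℕ; zero; suc; _+_; _∸_; _<_)
import Data.Nat.ListAction as ℕ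
open import Data.Product using (_×_; _,_)
open import Data.Vec as Vec using (Vec; lookup)
open import Data.Vec.Properties using (lookup-map; lookup-allFin)
open import Level using (Level; _⊔_)
open import Relation.Binary using (Rel; Decidable)
open import Relation.Binary.Construct.Closure.Equivalence as Eq using (EqClosure)
import Relation.Binary.Construct.On as On
open import Relation.Binary.PropositionalEquality
  using (_≡_; refl; sym; trans; cong; isEquivalence)
open import Relation.Nullary using (yes; no; ¬_; contradiction)
open import Relation.Nullary.Decidable using (map′)

------------------------------------------------------------------------
-- Polynomials

-- R[X]: coefficient lists, constant term first.  Trailing zeros are
-- allowed, so equality is equality of all coefficients.
module Polynomial {c ℓ : Level} (R : RawRing c ℓ) where
  private module R = RawRing R

  Poly : Set c
  Poly = List R.Carrier

  coeff : Poly → ℕ → R.Carrier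
  coeff []      _       = R.0#
  coeff (a ∷ p) zero    = a
  coeff (a ∷ p) (suc k) = coeff p k

  _≈ᴾ_ : Rel Poly ℓ
  p ≈ᴾ q = ∀ k → coeff p k R.≈ coeff q k

  _+ᴾ_ : Poly → Poly → Poly
  []      +ᴾ q       = q
  (a ∷ p) +ᴾ []      = a ∷ p
  (a ∷ p) +ᴾ (b ∷ q) = (a R.+ b) ∷ (p +ᴾ q)

  _*ᴾ_ : Poly → Poly → Poly
  []      *ᴾ q = []
  (a ∷ p) *ᴾ q = List.map (a R.*_) q +ᴾ (R.0# ∷ (p *ᴾ q))

  const : R.Carrier → Poly
  const a = a ∷ []

  var : Poly
  var = R.0# ∷ R.1# ∷ []

  rawRing : RawRing c ℓ
  rawRing = record
    { Carrier = Poly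
    ; _≈_     = _≈ᴾ_
    ; _+_     = _+ᴾ_
    ; _*_     = _*ᴾ_
    ; -_      = List.map R.-_
    ; 0#      = []
    ; 1#      = const R.1#
    }

private
  module ℤ[s]    = Polynomial +-*-rawRing
  module ℤ[s][t] = Polynomial ℤ[s].rawRing

-- ℤ[s,t] is ℤ[s][t].  The pair (s , t) plays the role of (x , y) in T-HG
-- and of (q , w) in Z-P and Z-Grimmett.
ℤ[s,t] : RawRing _ _
ℤ[s,t] = ℤ[s][t].rawRing

module ℤ[s,t] = RawRing ℤ[s,t]

open RawSemiringDefs ℤ[s,t].rawSemiring using (_^_)

s t : ℤ[s,t].Carrier
s = ℤ[s][t].const ℤ[s].var
t = ℤ[s][t].var

infixl 6 _⊖1
_⊖1 : ℤ[s,t].Carrier → ℤ[s,t].Carrier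
p ⊖1 = p ℤ[s,t].+ (ℤ[s,t].- ℤ[s,t].1#)

sum : List ℤ[s,t].Carrier → ℤ[s,t].Carrier
sum = foldr ℤ[s,t]._+_ ℤ[s,t].0#

product : List ℤ[s,t].Carrier → ℤ[s,t].Carrier
product = foldr ℤ[s,t]._*_ ℤ[s,t].1#

------------------------------------------------------------------------
-- Connected components of a finite multigraph on the vertex set Fin N,
-- given by its list of edges

EdgeList : ℕ → Set
EdgeList N = List (Fin N × Fin N)

Connected : ∀ {N} → EdgeList N → Rel (Fin N) _
Connected es = EqClosure λ i j → (i , j) ∈ es

-- The labelling gives two vertices the same label exactly when they are
-- connected; it serves only to decide Connected.
merge : ∀ {N} → Fin N → Fin N → Fin N → Fin N
merge a b c with c ≟ a
... | yes _ = b
... | no  _ = c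

mergeAll : ∀ {N} → Fin N × Fin N → Vec (Fin N) N → Vec (Fin N) N
mergeAll (i , j) ls = Vec.map (merge (lookup ls i) (lookup ls j)) ls

labels : ∀ {N} → EdgeList N → Vec (Fin N) N
labels = foldr mergeAll (Vec.allFin _)

private
  merge-source : ∀ {N} (a b : Fin N) → merge a b a ≡ b
  merge-source a b with a ≟ a
  ... | yes _  = refl
  ... | no a≢a = contradiction refl a≢a

  merge-target : ∀ {N} (a b : Fin N) → merge a b b ≡ b
  merge-target a b with b ≟ a
  ... | yes _ = refl
  ... | no  _ = refl

  weaken : ∀ {N} {e : Fin N × Fin N} {es x y} →
           Connected es x y → Connected (e ∷ es) x y
  weaken = Eq.map there

module _ {N : ℕ} where

  label-sound : (es : EdgeList N) → ∀ {x y} →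
                lookup (labels es) x ≡ lookup (labels es) y → Connected es x y
  label-sound [] {x} {y} eq
    rewrite lookup-allFin x | lookup-allFin y | eq = Eq.reflexive _
  label-sound ((i , j) ∷ es) {x} {y} eq
    rewrite lookup-map x (merge (lookup (labels es) i) (lookup (labels es) j)) (labels es)
          | lookup-map y (merge (lookup (labels es) i) (lookup (labels es) j)) (labels es)
    with lookup (labels es) x ≟ lookup (labels es) i
       | lookup (labels es) y ≟ lookup (labels es) i
  ... | yes x~i | yes y~i = weaken (label-sound es (trans x~i (sym y~i)))
  ... | yes x~i | no  _   =
    Eq.transitive _ (weaken (label-sound es x~i))
      (Eq.transitive _ (Eq.return (here refl)) (weaken (label-sound es eq)))
  ... | no  _   | yes y~i =
    Eq.transitive _ (weaken (label-sound es eq))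
      (Eq.transitive _ (Eq.symmetric _ (Eq.return (here refl)))
        (weaken (label-sound es (sym y~i))))
  ... | no  _   | no  _   = weaken (label-sound es eq)

  label-edge : (es : EdgeList N) → ∀ {x y} → (x , y) ∈ es →
               lookup (labels es) x ≡ lookup (labels es) y
  label-edge ((i , j) ∷ es) (here refl)
    rewrite lookup-map i (merge (lookup (labels es) i) (lookup (labels es) j)) (labels es)
          | lookup-map j (merge (lookup (labels es) i) (lookup (labels es) j)) (labels es)
    = trans (merge-source (lookup (labels es) i) _)
            (sym (merge-target (lookup (labels es) i) _))
  label-edge ((i , j) ∷ es) {x} {y} (there e)
    rewrite lookup-map x (merge (lookup (labels es) i) (lookup (labels es) j)) (labels es)
          | lookup-map y (merge (lookup (labels es) i) (lookup (labels es) j)) (labels es)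
    = cong (merge _ _) (label-edge es e)

  label-complete : (es : EdgeList N) → ∀ {x y} → Connected es x y →
                   lookup (labels es) x ≡ lookup (labels es) y
  label-complete es =
    Eq.fold (On.isEquivalence (lookup (labels es)) isEquivalence) (label-edge es)

  connected? : (es : EdgeList N) → Decidable (Connected es)
  connected? es x y =
    map′ (label-sound es) (label-complete es)
         (lookup (labels es) x ≟ lookup (labels es) y)

components : ∀ {N} → EdgeList N → ℕ
components {N} es = length (deduplicate (connected? es) (allFin N))

------------------------------------------------------------------------
-- Hypergraphs

-- A multiset of elements of Fin n is its vector of multiplicities.
record Hyperedge (n : ℕ) : Set where
  field
    multiplicity : Vec ℕ n

  d : ℕ
  d = Vec.sum multiplicity

  field
    d>1 : 1 < d

open Hyperedge using (multiplicity; d; d>1) public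

-- Hyperedges are identified by their position in the list E, so parallel
-- hyperedges are distinct.
record Hypergraph : Set where
  field
    v : ℕ
    E : List (Hyperedge v)

open Hypergraph public

totalDegree : ∀ {n} → List (Hyperedge n) → ℕ
totalDegree A = ℕ.sum (List.map d A)

-- The vertex u becomes u ↑ˡ length A, and the hyperedge at position e
-- becomes n ↑ʳ e.
incidenceGraph : ∀ {n} (A : List (Hyperedge n)) → EdgeList (n + length A)
incidenceGraph {n} A =
  concatMap (λ e →
    concatMap (λ u →
      replicate (lookup (multiplicity (List.lookup A e)) u)
                (u ↑ˡ length A , n ↑ʳ e))
      (allFin n))
    (allFin (length A))

-- κ A is the number of components of the hypergraph (Fin n , A).
κ : ∀ {n} → List (Hyperedge n) → ℕ
κ A = components (incidenceGraph A)

-- One sublist for each set of positions, so parallel elements are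
-- selected independently.
subsets : ∀ {a} {X : Set a} → List X → List (List X)
subsets []       = [] ∷ []
subsets (x ∷ xs) = subsets xs ++ List.map (x ∷_) (subsets xs)

∑[A⊆_]_ : ∀ {n} → List (Hyperedge n) →
          (List (Hyperedge n) → ℤ[s,t].Carrier) → ℤ[s,t].Carrier
∑[A⊆ E ] f = sum (List.map f (subsets E))

------------------------------------------------------------------------
-- The three polynomials

-- Neither truncated subtraction truncates: deleting hyperedges cannot
-- decrease κ, and each hyperedge e lowers the number of components by at
-- most d(e) - 1, so v(H) - κ(A) ≤ d(A) - |A|.
T-HG : Hypergraph → ℤ[s,t].Carrier
T-HG H = ∑[A⊆ E H ] λ A →
  ((s ⊖1) ^ (κ A ∸ κ (E H)))
    ℤ[s,t].* ((t ⊖1) ^ ((totalDegree A + κ A) ∸ (length A + v H)))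

Z-P : Hypergraph → ℤ[s,t].Carrier
Z-P H = ∑[A⊆ E H ] λ A →
  (s ^ κ A) ℤ[s,t].* product (List.map (λ e → (t ^ (d e ∸ 1)) ⊖1) A)

Z-Grimmett : Hypergraph → ℤ[s,t].Carrier
Z-Grimmett H = ∑[A⊆ E H ] λ A →
  (s ^ κ A) ℤ[s,t].* ((t ⊖1) ^ length A)

------------------------------------------------------------------------
-- Distinguishing power

Invariant : Set
Invariant = Hypergraph → ℤ[s,t].Carrier

LessDistinguishing : Invariant → Invariant → Set
LessDistinguishing F₁ F₂ =
  ∀ H H′ → F₂ H ℤ[s,t].≈ F₂ H′ → F₁ H ℤ[s,t].≈ F₁ H′

Incomparable : Invariant → Invariant → Set
Incomparable F₁ F₂ = ¬ LessDistinguishing F₁ F₂ × ¬ LessDistinguishing F₂ F₁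

record SameParameters (H H′ : Hypergraph) : Set where
  field
    same-v : v H ≡ v H′
    same-κ : κ (E H) ≡ κ (E H′)
    same-e : length (E H) ≡ length (E H′)
    same-d : totalDegree (E H) ≡ totalDegree (E H′)

data Name : Set where
  tHG zP zGrimmett : Name

⟦_⟧ : Name → Invariant
⟦ tHG ⟧       = T-HG
⟦ zP ⟧        = Z-P
⟦ zGrimmett ⟧ = Z-Grimmett

{-# OPTIONS --safe #-}

-- Each of the three polynomials has a blind spot, which gives one small pair
-- that it identifies while the other two polynomials separate it.
--   Z-Grimmett ignores degrees: let a loop and an edge joining two vertices
--   exchange their degrees.
--   Z-P: an edge e has weight w ^ (d e - 1) - 1, so on two vertices the loops
--   enter only through their total of d e - 1, and so do the joining edges.
--   A loop of degree 3 can be traded for two loops of degree 2 while two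
--   joining edges of degree 2 are traded for one of degree 3.
--   T-HG sees of a set A only κ(A) and d(A) - |A|: an edge e with d(e) = 3 may
--   exchange its value of κ with a pair of edges of degree 2.
module Submission where

open import Defs
open import Data.Integer using (+-*-rawRing)
open import Data.List using ([]; _∷_)
open import Data.Nat using (ℕ; _<?_)
open import Data.Product using (_×_; _,_; ∃₂)
open import Data.Vec as Vec using (Vec; []; _∷_)
open import Relation.Binary.PropositionalEquality using (_≡_; _≢_; refl; ≢-sym)
open import Relation.Nullary using (¬_; contradiction)
open import Relation.Nullary.Decidable using (True; toWitness)

private
  module ℤ[s] = Polynomial +-*-rawRing
  module ℤ[s][t] = Polynomial ℤ[s].rawRing

≈-reflexive : ∀ {p q} → p ≡ q → p ℤ[s,t].≈ q
≈-reflexive refl _ _ = refl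

-- `k` is the exponent of `t` and `l` that of `s`.
≉-by-coeff : ∀ {p q} k l →
             ℤ[s].coeff (ℤ[s][t].coeff p k) l ≢ ℤ[s].coeff (ℤ[s][t].coeff q k) l →
             ¬ (p ℤ[s,t].≈ q)
≉-by-coeff k l p≢q p≈q = p≢q (p≈q k l)

edge : ∀ {n} (m : Vec ℕ n) {m>1 : True (1 <? Vec.sum m)} → Hyperedge n
edge m {m>1} = record { multiplicity = m ; d>1 = toWitness m>1 }

Grimmett₁ Grimmett₂ : Hypergraph
Grimmett₁ = record { v = 2 ; E = edge (2 ∷ 0 ∷ []) ∷ edge (1 ∷ 2 ∷ []) ∷ [] }
Grimmett₂ = record { v = 2 ; E = edge (3 ∷ 0 ∷ []) ∷ edge (1 ∷ 1 ∷ []) ∷ [] }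

P₁ P₂ : Hypergraph
P₁ = record
  { v = 2
  ; E = edge (2 ∷ 0 ∷ []) ∷ edge (2 ∷ 0 ∷ []) ∷ edge (1 ∷ 2 ∷ []) ∷ []
  }
P₂ = record
  { v = 2
  ; E = edge (3 ∷ 0 ∷ []) ∷ edge (1 ∷ 1 ∷ []) ∷ edge (1 ∷ 1 ∷ []) ∷ []
  }

HG₁ HG₂ : Hypergraph
HG₁ = record
  { v = 3
  ; E = edge (1 ∷ 1 ∷ 0 ∷ []) ∷ edge (1 ∷ 1 ∷ 0 ∷ []) ∷ edge (1 ∷ 1 ∷ 1 ∷ []) ∷ []
  }
HG₂ = record
  { v = 3
  -- The multiplicity 2 keeps the degree at 3 while only two vertices are joined.
  ; E = edge (1 ∷ 1 ∷ 0 ∷ []) ∷ edge (1 ∷ 0 ∷ 1 ∷ []) ∷ edge (0 ∷ 2 ∷ 1 ∷ []) ∷ []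
  }

sameParameters-Grimmett : SameParameters Grimmett₁ Grimmett₂
sameParameters-Grimmett =
  record { same-v = refl ; same-κ = refl ; same-e = refl ; same-d = refl }

sameParameters-P : SameParameters P₁ P₂
sameParameters-P =
  record { same-v = refl ; same-κ = refl ; same-e = refl ; same-d = refl }

sameParameters-HG : SameParameters HG₁ HG₂
sameParameters-HG =
  record { same-v = refl ; same-κ = refl ; same-e = refl ; same-d = refl }

Grimmett-agree : Z-Grimmett Grimmett₁ ≡ Z-Grimmett Grimmett₂
Grimmett-agree = refl

P-agree : Z-P P₁ ≡ Z-P P₂
P-agree = refl

HG-agree : T-HG HG₁ ≡ T-HG HG₂
HG-agree = refl

separation : ∀ (F₁ F₂ : Name) → F₁ ≢ F₂ →
  ∃₂ λ (H H′ : Hypergraph) →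
    SameParameters H H′
    × ⟦ F₁ ⟧ H ℤ[s,t].≈ ⟦ F₁ ⟧ H′
    × ¬ (⟦ F₂ ⟧ H ℤ[s,t].≈ ⟦ F₂ ⟧ H′)
separation tHG tHG F₁≢F₂ = contradiction refl F₁≢F₂
separation zP zP F₁≢F₂ = contradiction refl F₁≢F₂
separation zGrimmett zGrimmett F₁≢F₂ = contradiction refl F₁≢F₂
separation tHG zP _ =
  HG₁ , HG₂ , sameParameters-HG , ≈-reflexive HG-agree ,
  -- At `t = 0` every edge weighs -1, leaving the sum of (-1)^|A| over κ(A) = 1: 0 against 2.
  ≉-by-coeff {Z-P HG₁} {Z-P HG₂} 0 1 λ ()
separation tHG zGrimmett _ =
  HG₁ , HG₂ , sameParameters-HG , ≈-reflexive HG-agree ,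
  ≉-by-coeff {Z-Grimmett HG₁} {Z-Grimmett HG₂} 0 1 λ ()
separation zP tHG _ =
  P₁ , P₂ , sameParameters-P , ≈-reflexive P-agree ,
  -- The sum of (-1)^(d(A) - |A|) over sets of loops: 0 against 2.
  ≉-by-coeff {T-HG P₁} {T-HG P₂} 0 1 λ ()
separation zP zGrimmett _ =
  P₁ , P₂ , sameParameters-P , ≈-reflexive P-agree ,
  -- Each loop gives a factor `t`, so `s` has coefficient t^2 (t - 1) against t (t^2 - 1).
  ≉-by-coeff {Z-Grimmett P₁} {Z-Grimmett P₂} 1 1 λ ()
separation zGrimmett tHG _ =
  Grimmett₁ , Grimmett₂ , sameParameters-Grimmett , ≈-reflexive Grimmett-agree ,
  ≉-by-coeff {T-HG Grimmett₁} {T-HG Grimmett₂} 0 1 λ ()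
separation zGrimmett zP _ =
  Grimmett₁ , Grimmett₂ , sameParameters-Grimmett , ≈-reflexive Grimmett-agree ,
  -- The coefficient of `s` is t (t^2 - 1) against t^2 (t - 1).
  ≉-by-coeff {Z-P Grimmett₁} {Z-P Grimmett₂} 1 1 λ ()

separated⇒¬lessDistinguishing : ∀ {F₁ F₂ : Invariant} →
  (∃₂ λ (H H′ : Hypergraph) →
    SameParameters H H′ × F₂ H ℤ[s,t].≈ F₂ H′ × ¬ (F₁ H ℤ[s,t].≈ F₁ H′)) →
  ¬ LessDistinguishing F₁ F₂
separated⇒¬lessDistinguishing (H , H′ , _ , F₂-agree , F₁-differ) F₁≤F₂ =
  F₁-differ (F₁≤F₂ H H′ F₂-agree)

theorem5p8 : ∀ (F₁ F₂ : Name) → F₁ ≢ F₂ →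
    Incomparable ⟦ F₁ ⟧ ⟦ F₂ ⟧
    × ∃₂ λ (H H′ : Hypergraph) →
    SameParameters H H′
    × ⟦ F₁ ⟧ H ℤ[s,t].≈ ⟦ F₁ ⟧ H′
    × ¬ (⟦ F₂ ⟧ H ℤ[s,t].≈ ⟦ F₂ ⟧ H′)
theorem5p8 F₁ F₂ F₁≢F₂ =
  ( separated⇒¬lessDistinguishing {⟦ F₁ ⟧} {⟦ F₂ ⟧} (separation F₂ F₁ (≢-sym F₁≢F₂))
  , separated⇒¬lessDistinguishing {⟦ F₂ ⟧} {⟦ F₁ ⟧} (separation F₁ F₂ F₁≢F₂)
  ) , separation F₁ F₂ F₁≢F₂
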